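{- For every integer $n \geqslant 3$, the line graph $L(W_{n+1})$ of the wheel $W_{n+1}$ is not representable.
   Context: All graphs are finite and simple. For a word $W$ over an alphabet, two distinct letters $x,y$ alternate in $W$ if both occur in $W$ and, after erasing all other letters from $W$, one obtains a word of the form $xyxy\ldots$ or $yxyx\ldots$ (an alternating word of any length). A graph $G=(V,E)$ is representable if there exists a word $W$ over the alphabet $V$ in which every vertex occurs, such that for all distinct $x,y\in V$, the letters $x$ and $y$ alternate in $W$ if and only if $(x,y)\in E$. The wheel $W_m$ is the graph obtained from the cycle $C_m$ on $m$ vertices by adding one new vertex adjacent to all vertices of the cycle. The line graph $L(G)$ of a graph $G$ has the edges of $G$ as vertices, two of them being adjacent in $L(G)$ iff they share an endpoint in $G$. -}

module Defs where

open import Data.Nat using (ℕ; zero; suc)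
import Data.Nat.Properties as ℕ
open import Data.Fin using (Fin; zero; suc; toℕ; _<_)
open import Data.Fin.Properties using (_≟_; _<?_; any?)
open import Data.List using (List; []; _∷_; length; lookup; filter; allFin; cartesianProduct)
open import Data.List.Membership.Propositional using (_∈_)
open import Data.Product using (_×_; _,_; ∃; ∃-syntax)
open import Data.Sum using (_⊎_)
import Data.Sum as Sum
open import Data.Empty using (⊥)
open import Data.Unit using (⊤; tt)
open import Function using (_∘_)
open import Function.Bundles using (_⇔_)
open import Level using (0ℓ)
open import Relation.Binary using (Rel; Decidable; Symmetric; Irreflexive)
open import Relation.Binary.PropositionalEquality using (_≡_; _≢_; refl; sym)
open import Relation.Nullary using (yes; no)
open import Relation.Nullary.Decidable using (_×-dec_; _⊎-dec_; ¬?)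

record Graph (n : ℕ) : Set₁ where
  field
    _~_      : Rel (Fin n) 0ℓ
    _~?_     : Decidable _~_
    ~-sym    : Symmetric _~_
    ~-irrefl : Irreflexive _≡_ _~_

-- Words

-- The word is x y x y … (of any length, including zero).
data AlternatingFrom {n : ℕ} (x y : Fin n) : List (Fin n) → Set where
  []  : AlternatingFrom x y []
  _∷_ : ∀ {z w} → z ≡ x → AlternatingFrom y x w → AlternatingFrom x y (z ∷ w)

restrict : ∀ {n} → Fin n → Fin n → List (Fin n) → List (Fin n)
restrict x y = filter (λ z → (z ≟ x) ⊎-dec (z ≟ y))

Alternate : ∀ {n} → Fin n → Fin n → List (Fin n) → Set
Alternate x y w =
  x ∈ w × y ∈ w ×
  (AlternatingFrom x y (restrict x y w) ⊎ AlternatingFrom y x (restrict x y w))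

Representable : ∀ {n} → Graph n → Set
Representable {n} G =
  ∃[ w ] (∀ v → v ∈ w) × (∀ (x y : Fin n) → x ≢ y → Alternate x y w ⇔ x ~ y)
  where open Graph G

-- Wheels

Successive : ∀ {m} → Rel (Fin m) 0ℓ
Successive {m} i j = toℕ j ≡ suc (toℕ i) ⊎ (suc (toℕ i) ≡ m × toℕ j ≡ 0)

-- The condition i ≢ j is redundant unless m ≡ 1; it makes the definition
-- total in m. For m ≥ 3 this is the usual cycle on m vertices.
cycle : (m : ℕ) → Graph m
cycle m = record
  { _~_      = λ i j → i ≢ j × (Successive i j ⊎ Successive j i)
  ; _~?_     = λ i j → ¬? (i ≟ j) ×-dec (successive? i j ⊎-dec successive? j i)
  ; ~-sym    = λ (i≢j , s) → i≢j ∘ sym , Sum.swap s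
  ; ~-irrefl = λ i≡j (i≢j , _) → i≢j i≡j
  }
  where
  successive? : Decidable (Successive {m})
  successive? i j =
    (toℕ j ℕ.≟ suc (toℕ i)) ⊎-dec ((suc (toℕ i) ℕ.≟ m) ×-dec (toℕ j ℕ.≟ 0))

-- The new vertex is zero; each old vertex v becomes suc v.
addUniversalVertex : ∀ {n} → Graph n → Graph (suc n)
addUniversalVertex {n} G = record
  { _~_ = _~⁺_ ; _~?_ = dec ; ~-sym = λ {u} {v} → symm u v ; ~-irrefl = irr }
  where
  open Graph G

  _~⁺_ : Rel (Fin (suc n)) 0ℓ
  zero  ~⁺ zero  = ⊥
  zero  ~⁺ suc _ = ⊤
  suc _ ~⁺ zero  = ⊤
  suc u ~⁺ suc v = u ~ v

  dec : Decidable _~⁺_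
  dec zero    zero    = no λ ()
  dec zero    (suc _) = yes tt
  dec (suc _) zero    = yes tt
  dec (suc u) (suc v) = u ~? v

  symm : ∀ u v → u ~⁺ v → v ~⁺ u
  symm zero    (suc _) _ = tt
  symm (suc _) zero    _ = tt
  symm (suc _) (suc _) p = ~-sym p

  irr : Irreflexive _≡_ _~⁺_
  irr {suc _} refl p = ~-irrefl refl p

wheel : (m : ℕ) → Graph (suc m)
wheel m = addUniversalVertex (cycle m)

-- Line graphs

-- Each edge is listed exactly once, as the pair of its endpoints in
-- increasing order.
edges : ∀ {n} → Graph n → List (Fin n × Fin n)
edges {n} G =
  filter (λ (u , v) → (u <? v) ×-dec (u ~? v)) (cartesianProduct (allFin n) (allFin n))
  where open Graph G

_IsEndpointOf_ : ∀ {n} → Fin n → Fin n × Fin n → Set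
u IsEndpointOf (a , b) = u ≡ a ⊎ u ≡ b

ShareEndpoint : ∀ {n} → Rel (Fin n × Fin n) 0ℓ
ShareEndpoint e f = ∃ λ u → u IsEndpointOf e × u IsEndpointOf f

-- The vertex i stands for the i-th entry of the list of edges.
lineGraph : ∀ {n} (G : Graph n) → Graph (length (edges G))
lineGraph G = record
  { _~_      = λ i j → i ≢ j × ShareEndpoint (edge i) (edge j)
  ; _~?_     = λ i j → ¬? (i ≟ j) ×-dec share? (edge i) (edge j)
  ; ~-sym    = λ (i≢j , u , p , q) → i≢j ∘ sym , u , q , p
  ; ~-irrefl = λ i≡j (i≢j , _) → i≢j i≡j
  }
  where
  edge = lookup (edges G)

  endpoint? : ∀ {n} → Decidable (_IsEndpointOf_ {n})
  endpoint? u (a , b) = (u ≟ a) ⊎-dec (u ≟ b)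

  share? : ∀ {n} → Decidable (ShareEndpoint {n})
  share? e f = any? λ u → endpoint? u e ×-dec endpoint? u f

{-# OPTIONS --safe #-}
module Submission where

-- Let c_v(t) be the number of occurrences of v among the first t letters of a
-- word. Two letters alternate iff c_x − c_y takes at most two values, and these
-- are consecutive; this is invariant under adding constants to the c_v. Hence
-- any shifts of the counts of two adjacent vertices are pointwise comparable,
-- and conversely p ≤ q ≤ p + 1 makes the vertices of p and q adjacent.
--
-- Shift the counts of the spokes s_i to S_i with S_0 − 1 ≤ S_i ≤ S_0. A rim edge
-- is adjacent to exactly two spokes, which forces these to be neighbours in the
-- cyclic order of the S_i. Up to replacing c by −c, this gives
-- S_0 ≥ S_1 ≥ … ≥ S_n ≥ S_0 − 1, and shifts R_i of the counts of the rim edges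
-- with R_i ≤ S_{i+1} and S_i ≤ R_i + 1, while the rim edge closing the cycle has
-- a shift C with S_n ≤ C ≤ S_0. If R_i ≤ R_{i+1}, then the i-th rim edge would be
-- adjacent to s_{i+2}; so R_0 ≥ R_1 ≥ … and, for the same reason,
-- R_0 ≤ C ≤ R_{n-1} + 1. Thus R_2 ≤ R_0 ≤ R_2 + 1, although the rim edges 0 and 2
-- are disjoint.

open import Defs
open import Data.Nat using (ℕ; suc; _≥_)
open import Relation.Nullary using (¬_)

open import Data.Nat as ℕ using (zero; z≤n; s≤s)
import Data.Nat.Properties as ℕ
open import Data.Integer as ℤ using (ℤ; +_; -[1+_]; 0ℤ; 1ℤ; +≤+)
import Data.Integer.Properties as ℤ
open import Data.Integer.Tactic.RingSolver using (solve-∀)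
open import Data.Fin as Fin using (Fin; zero; suc; toℕ; fromℕ; inject₁)
import Data.Fin.Properties as Fin
open import Data.Fin.Induction using (<-weakInduction; >-weakInduction)
open import Data.List using (List; []; _∷_; length; lookup; filter; take)
open import Data.List.Properties using (filter-≐)
open import Data.List.Membership.Propositional using (_∈_)
open import Data.List.Membership.Propositional.Properties
  using (∈-filter⁺; ∈-cartesianProduct⁺; ∈-allFin)
open import Data.List.Relation.Unary.Any using (index)
open import Data.List.Relation.Unary.Any.Properties using (lookup-index)
open import Data.Product using (_×_; _,_; ∃; proj₁; proj₂)
open import Data.Sum as Sum using (_⊎_; inj₁; inj₂; [_,_]′)
open import Data.Empty using (⊥; ⊥-elim)
open import Data.Unit using (tt)
open import Function using (_∘_)
open import Function.Bundles using (_⇔_; mk⇔; Equivalence)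
open import Level using (0ℓ)
open import Relation.Binary using (Rel)
open import Relation.Binary.PropositionalEquality
  using (_≡_; _≢_; refl; sym; trans; cong; subst; subst₂)
open import Relation.Nullary using (yes; no; contradiction)
open import Relation.Nullary.Decidable using (_×-dec_)

open Equivalence using (to; from)

-- Families of integer functions, up to additive constants.

≤-by-difference : ∀ {a b c d} → a ℤ.≤ b → b ℤ.- a ≡ d ℤ.- c → c ℤ.≤ d
≤-by-difference a≤b eq = ℤ.0≤i-j⇒j≤i (subst (0ℤ ℤ.≤_) eq (ℤ.i≤j⇒0≤j-i a≤b))

module _ {T V : Set} where

  -- For prefix counts of a word this is alternation. The values are integers rather than naturals
  -- so that a family can be negated.
  Close : (V → T → ℤ) → Rel V 0ℓ
  Close c u v = ∃ λ k → ∀ t → k ℤ.≤ c u t ℤ.- c v t × c u t ℤ.- c v t ℤ.≤ ℤ.suc k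

  Close-refl : ∀ c {u} → Close c u u
  Close-refl c {u} = 0ℤ , λ t →
    ℤ.≤-reflexive (sym (ℤ.+-inverseʳ (c u t))) ,
    ℤ.≤-trans (ℤ.≤-reflexive (ℤ.+-inverseʳ (c u t))) (+≤+ z≤n)

  opposite : (V → T → ℤ) → V → T → ℤ
  opposite c v t = ℤ.- c v t

  Close-opposite : ∀ c {u v} → Close c u v → Close (opposite c) u v
  Close-opposite c {u} {v} (k , bounds) = ℤ.- ℤ.suc k , λ t →
    ≤-by-difference (proj₂ (bounds t)) (lower k (c u t) (c v t)) ,
    ≤-by-difference (proj₁ (bounds t)) (upper k (c u t) (c v t))
    where
    lower : ∀ k a b →
      (1ℤ ℤ.+ k) ℤ.- (a ℤ.- b) ≡ ((ℤ.- a) ℤ.- (ℤ.- b)) ℤ.- (ℤ.- (1ℤ ℤ.+ k))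
    lower = solve-∀
    upper : ∀ k a b →
      (a ℤ.- b) ℤ.- k ≡ (1ℤ ℤ.+ (ℤ.- (1ℤ ℤ.+ k))) ℤ.- ((ℤ.- a) ℤ.- (ℤ.- b))
    upper = solve-∀

  -- A second use of `Close-opposite` would end in `- (- c)`, which agrees with `c` only pointwise.
  Close-opposite⁻ : ∀ c {u v} → Close (opposite c) u v → Close c u v
  Close-opposite⁻ c {u} {v} (k , bounds) = ℤ.- ℤ.suc k , λ t →
    ≤-by-difference (proj₂ (bounds t)) (lower k (c u t) (c v t)) ,
    ≤-by-difference (proj₁ (bounds t)) (upper k (c u t) (c v t))
    where
    lower : ∀ k a b →
      (1ℤ ℤ.+ k) ℤ.- ((ℤ.- a) ℤ.- (ℤ.- b)) ≡ (a ℤ.- b) ℤ.- (ℤ.- (1ℤ ℤ.+ k))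
    lower = solve-∀
    upper : ∀ k a b →
      ((ℤ.- a) ℤ.- (ℤ.- b)) ℤ.- k ≡ (1ℤ ℤ.+ (ℤ.- (1ℤ ℤ.+ k))) ℤ.- (a ℤ.- b)
    upper = solve-∀

-- The pair (v , k) stands for the function c v + k.
module Shifts {T V : Set} (c : V → T → ℤ) where

  Shift : Set
  Shift = V × ℤ

  ⟦_⟧ : Shift → T → ℤ
  ⟦ v , k ⟧ t = c v t ℤ.+ k

  infix 4 _≼_
  record _≼_ (p q : Shift) : Set where
    constructor pointwise
    field at : ∀ t → ⟦ p ⟧ t ℤ.≤ ⟦ q ⟧ t

  open _≼_ public

  up : Shift → Shift
  up (v , k) = v , ℤ.suc k

  ≼-refl : ∀ {p} → p ≼ p
  ≼-refl = pointwise λ t → ℤ.≤-refl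

  infixr 5 _⊙_
  _⊙_ : ∀ {p q r} → p ≼ q → q ≼ r → p ≼ r
  p≼q ⊙ q≼r = pointwise λ t → ℤ.≤-trans (at p≼q t) (at q≼r t)

  ≼-up : ∀ {p} → p ≼ up p
  ≼-up {v , i} = pointwise λ t → ℤ.+-monoʳ-≤ (c v t) (ℤ.i≤j⇒i≤1+j ℤ.≤-refl)

  abstract
    up-mono : ∀ {p q} → p ≼ q → up p ≼ up q
    up-mono {u , i} {v , j} p≼q = pointwise λ t →
      ≤-by-difference (at p≼q t) (eq (c u t) (c v t) i j)
      where
      eq : ∀ a b i j →
        (b ℤ.+ j) ℤ.- (a ℤ.+ i) ≡ (b ℤ.+ (1ℤ ℤ.+ j)) ℤ.- (a ℤ.+ (1ℤ ℤ.+ i))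
      eq = solve-∀

    squeeze⇒Close : ∀ {p q} → p ≼ q → q ≼ up p → Close c (proj₁ q) (proj₁ p)
    squeeze⇒Close {u , i} {v , j} p≼q q≼p⁺ = i ℤ.- j , λ t →
      ≤-by-difference (at p≼q t) (lower (c u t) (c v t) i j) ,
      ≤-by-difference (at q≼p⁺ t) (upper (c u t) (c v t) i j)
      where
      lower : ∀ a b i j → (b ℤ.+ j) ℤ.- (a ℤ.+ i) ≡ (b ℤ.- a) ℤ.- (i ℤ.- j)
      lower = solve-∀
      upper : ∀ a b i j →
        (a ℤ.+ (1ℤ ℤ.+ i)) ℤ.- (b ℤ.+ j) ≡ (1ℤ ℤ.+ (i ℤ.- j)) ℤ.- (b ℤ.- a)
      upper = solve-∀

    Close⇒squeeze : ∀ {u v} → Close c u v → ∀ j →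
      ∃ λ i → (u , i) ≼ (v , j) × (v , j) ≼ up (u , i)
    -- This shift lifts the larger possible value `suc k` of `c u - c v` exactly to the level of
    -- `j`.
    Close⇒squeeze {u} {v} (k , bounds) j = j ℤ.- ℤ.suc k ,
      (pointwise λ t → ≤-by-difference (proj₂ (bounds t)) (lower (c u t) (c v t) j k)) ,
      (pointwise λ t → ≤-by-difference (proj₁ (bounds t)) (upper (c u t) (c v t) j k))
      where
      lower : ∀ a b j k →
        (1ℤ ℤ.+ k) ℤ.- (a ℤ.- b) ≡ (b ℤ.+ j) ℤ.- (a ℤ.+ (j ℤ.- (1ℤ ℤ.+ k)))
      lower = solve-∀
      upper : ∀ a b j k →
        (a ℤ.- b) ℤ.- k ≡ (a ℤ.+ (1ℤ ℤ.+ (j ℤ.- (1ℤ ℤ.+ k)))) ℤ.- (b ℤ.+ j)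
      upper = solve-∀

    -- No integer lies strictly between `k` and `k + 1`, so `j - i` is on one side of both possible
    -- values of `c u - c v`.
    Close⇒comparable : ∀ {u v} → Close c u v → ∀ i j →
      (u , i) ≼ (v , j) ⊎ (v , j) ≼ (u , i)
    Close⇒comparable {u} {v} (k , bounds) i j with (j ℤ.- i) ℤ.≤? k
    ... | yes j-i≤k = inj₂ (pointwise λ t →
            ≤-by-difference (ℤ.≤-trans j-i≤k (proj₁ (bounds t))) (eq (c u t) (c v t) i j))
      where
      eq : ∀ a b i j → (a ℤ.- b) ℤ.- (j ℤ.- i) ≡ (a ℤ.+ i) ℤ.- (b ℤ.+ j)
      eq = solve-∀
    ... | no j-i≰k = inj₁ (pointwise λ t →
            ≤-by-difference
              (ℤ.≤-trans (proj₂ (bounds t)) (ℤ.i<j⇒suc[i]≤j (ℤ.≰⇒> j-i≰k)))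
              (eq (c u t) (c v t) i j))
      where
      eq : ∀ a b i j → (j ℤ.- i) ℤ.- (a ℤ.- b) ≡ (b ℤ.+ j) ℤ.- (a ℤ.+ i)
      eq = solve-∀

-- The cyclic order of the spokes and the contradiction.

-- The line graph of the wheel with k + 4 spokes, as a pattern in a relation:
-- rim i joins the ends of the spokes i and i + 1, and closing joins those of
-- the last spoke and the first one.
record LineGraphOfWheel (k : ℕ) {V : Set} (_~_ : Rel V 0ℓ) : Set where
  field
    spoke   : Fin (4 ℕ.+ k) → V
    rim     : Fin (3 ℕ.+ k) → V
    closing : V

    spoke~spoke   : ∀ i j → spoke i ~ spoke j
    rim~spokeˡ    : ∀ i → rim i ~ spoke (inject₁ i)
    rim~spokeʳ    : ∀ i → rim i ~ spoke (suc i)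
    rim≁spoke     : ∀ {i x} → x ≢ inject₁ i → x ≢ suc i → ¬ rim i ~ spoke x
    closing~first : closing ~ spoke zero
    closing~last  : closing ~ spoke (fromℕ (3 ℕ.+ k))
    closing≁spoke : ∀ {x} → x ≢ zero → x ≢ fromℕ (3 ℕ.+ k) → ¬ closing ~ spoke x
    rim~rim       : ∀ i → rim (inject₁ i) ~ rim (suc i)
    rim~closing   : rim (fromℕ (2 ℕ.+ k)) ~ closing
    closing~rim   : closing ~ rim zero
    rim≁rim       : ¬ rim zero ~ rim (suc (suc zero))

module _ {T V : Set} {_~_ : Rel V 0ℓ} {k : ℕ} (W : LineGraphOfWheel k _~_) where

  open LineGraphOfWheel W

  module _ (c : V → T → ℤ) (~⇔Close : ∀ u v → u ~ v ⇔ Close c u v) where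

    open Shifts c

    squeeze⇒~ : ∀ {p q} → p ≼ q → q ≼ up p → proj₁ q ~ proj₁ p
    squeeze⇒~ p≼q q≼p⁺ = from (~⇔Close _ _) (squeeze⇒Close p≼q q≼p⁺)

    -- The roles switch along `q ≼ up p ≼ up q`.
    squeeze⇒~˘ : ∀ {p q} → p ≼ q → q ≼ up p → proj₁ p ~ proj₁ q
    squeeze⇒~˘ p≼q q≼p⁺ = from (~⇔Close _ _) (squeeze⇒Close q≼p⁺ (up-mono p≼q))

    comparable : ∀ {u v} → u ~ v → ∀ i j → (u , i) ≼ (v , j) ⊎ (v , j) ≼ (u , i)
    comparable u~v = Close⇒comparable (to (~⇔Close _ _) u~v)

    -- When `b ≼ a ≼ up b`, shifts are arranged cyclically modulo `up`: some shift of `u` lies on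
    -- the arc from `b` to `a` (`Inside`) or on the complementary arc from `a - 1` to `b`
    -- (`Outside`).
    Outside Inside : V → Rel Shift 0ℓ
    Outside u a b = ∃ λ i → (u , i) ≼ b × a ≼ up (u , i)
    Inside  u a b = ∃ λ i → b ≼ (u , i) × (u , i) ≼ a

    abstract
      -- Closeness to `a` puts a shift of `u` between `a - 1` and `a`; comparing it with `b` selects
      -- the arc.
      outside⊎inside : ∀ {u} a b → u ~ proj₁ a → u ~ proj₁ b → Outside u a b ⊎ Inside u a b
      outside⊎inside a b u~a u~b
        with Close⇒squeeze (to (~⇔Close _ _) u~a) (proj₂ a)
      ... | i , x≼a , a≼x⁺ with comparable u~b i (proj₂ b)
      ...   | inj₁ x≼b = inj₁ (i , x≼b , a≼x⁺)
      ...   | inj₂ b≼x = inj₂ (i , b≼x , x≼a)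

    module Chain (shift : Fin (4 ℕ.+ k) → ℤ) where

      S : Fin (4 ℕ.+ k) → Shift
      S i = spoke i , shift i

      module _ (S≼S₀ : ∀ i → S i ≼ S zero) (S₀≼S⁺ : ∀ i → S zero ≼ up (S i))
               -- This fixes the direction of the cyclic order; negating the counts reduces the
               -- other direction to it.
               (first : Outside (rim zero) (S zero) (S (suc zero))) where

        Dominates : Fin (4 ℕ.+ k) → Set
        Dominates i = ∀ x → i Fin.≤ x → S x ≼ S i

        abstract
          -- For i > 0, a rim edge inside would satisfy S_0 - 1 ≤ S_{i+1} ≤ x ≤ S_i ≤ S_0 and so be
          -- adjacent to spoke 0. For i = 0 that spoke is an end of the rim edge, whence the
          -- assumption `first`.
          outside : ∀ i → Dominates (inject₁ i) →
                    Outside (rim i) (S (inject₁ i)) (S (suc i))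
          outside zero    _ = first
          outside (suc i) dom
            with outside⊎inside (S (inject₁ (suc i))) (S (suc (suc i)))
                   (rim~spokeˡ (suc i)) (rim~spokeʳ (suc i))
          ... | inj₁ out = out
          ... | inj₂ (_ , S≼x , x≼S) =
            ⊥-elim (rim≁spoke {x = zero} (λ ()) (λ ())
              (squeeze⇒~˘ (x≼S ⊙ S≼S₀ _) (S₀≼S⁺ _ ⊙ up-mono S≼x)))

        -- A later spoke above S_{i+1} would give r ≤ S_{i+1} ≤ S_x ≤ S_i ≤ r + 1 for the shift r of
        -- the i-th rim edge, a third spoke adjacent to it.
        dominates-step : ∀ i → Dominates (inject₁ i) → Dominates (suc i)
        dominates-step i dom x i<x with x Fin.≟ suc i
        ... | yes refl = ≼-refl
        ... | no x≢1+i
          with outside i dom | comparable (spoke~spoke x (suc i)) (shift x) (shift (suc i))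
        ...   | _ , _ , _ | inj₁ Sx≼S = Sx≼S
        ...   | _ , r≼S , S≼r⁺ | inj₂ S≼Sx =
          ⊥-elim (rim≁spoke x≢i x≢1+i
            (squeeze⇒~˘ (r≼S ⊙ S≼Sx) (dom x i≤x ⊙ S≼r⁺)))
          where
          i≤x : inject₁ i Fin.≤ x
          i≤x = subst (ℕ._≤ toℕ x) (sym (Fin.toℕ-inject₁ i)) (ℕ.<⇒≤ i<x)
          x≢i : x ≢ inject₁ i
          x≢i refl = ℕ.1+n≰n (subst (toℕ i ℕ.<_) (Fin.toℕ-inject₁ i) i<x)

        dominates : ∀ i → Dominates i
        dominates = <-weakInduction Dominates (λ x _ → S≼S₀ x) dominates-step

        S-descending : ∀ i → S (suc i) ≼ S (inject₁ i)
        S-descending i = dominates (inject₁ i) (suc i)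
          (subst (ℕ._≤ suc (toℕ i)) (sym (Fin.toℕ-inject₁ i)) (ℕ.n≤1+n _))

        last : Fin (4 ℕ.+ k)
        last = fromℕ (3 ℕ.+ k)

        last≼S : ∀ i → S last ≼ S i
        last≼S i = dominates i last (Fin.≤fromℕ i)

        R : Fin (3 ℕ.+ k) → Shift
        R i = rim i , proj₁ (outside i (dominates _))

        R≼S : ∀ i → R i ≼ S (suc i)
        R≼S i = proj₁ (proj₂ (outside i (dominates _)))

        S≼R⁺ : ∀ i → S (inject₁ i) ≼ up (R i)
        S≼R⁺ i = proj₂ (proj₂ (outside i (dominates _)))

        abstract
          -- Outside, x ≤ S_last ≤ S_1 ≤ S_0 ≤ x + 1 would make the closing edge adjacent to spoke
          -- 1.
          closing-inside : Inside closing (S zero) (S last)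
          closing-inside with outside⊎inside (S zero) (S last) closing~first closing~last
          ... | inj₂ ins = ins
          ... | inj₁ (_ , x≼S , S≼x⁺) =
            ⊥-elim (closing≁spoke {x = suc zero} (λ ()) (λ ())
              (squeeze⇒~˘ (x≼S ⊙ last≼S _) (S≼S₀ _ ⊙ S≼x⁺)))

        C : Shift
        C = closing , proj₁ closing-inside

        S≼C : S last ≼ C
        S≼C = proj₁ (proj₂ closing-inside)

        C≼S : C ≼ S zero
        C≼S = proj₂ (proj₂ closing-inside)

        R-descending : ∀ i → R (suc i) ≼ R (inject₁ i)
        R-descending i
          with comparable (rim~rim i) (proj₂ (R (inject₁ i))) (proj₂ (R (suc i)))
        ... | inj₂ R′≼R = R′≼R
        ... | inj₁ R≼R′ =
          ⊥-elim (rim≁spoke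
            (λ eq → ℕ.1+n≰n (ℕ.≤-trans (ℕ.n≤1+n _) (ℕ.≤-reflexive (values eq))))
            (λ eq → ℕ.1+n≢n (trans (cong toℕ (Fin.suc-injective eq)) (Fin.toℕ-inject₁ i)))
            (squeeze⇒~˘ (R≼R′ ⊙ R≼S (suc i))
              (S-descending (suc i) ⊙ S-descending (inject₁ i) ⊙ S≼R⁺ (inject₁ i))))
          where
          values : suc (suc i) ≡ inject₁ (inject₁ i) → suc (suc (toℕ i)) ≡ toℕ i
          values eq = trans (cong toℕ eq)
            (trans (Fin.toℕ-inject₁ (inject₁ i)) (Fin.toℕ-inject₁ i))

        lastRim : Fin (3 ℕ.+ k)
        lastRim = fromℕ (2 ℕ.+ k)

        C≼lastRim⁺ : C ≼ up (R lastRim)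
        C≼lastRim⁺ with comparable rim~closing (proj₂ (up (R lastRim))) (proj₂ C)
        ... | inj₂ C≼R⁺ = C≼R⁺
        ... | inj₁ R⁺≼C =
          -- With R the last rim shift: R + 1 ≤ C ≤ S_0 ≤ S_{last-1} + 1 ≤ R + 2.
          ⊥-elim (rim≁spoke {x = zero} (λ ()) (λ ())
            (squeeze⇒~˘ (R⁺≼C ⊙ C≼S) (S₀≼S⁺ (inject₁ lastRim) ⊙ up-mono (S≼R⁺ lastRim))))

        R₀≼C : R zero ≼ C
        R₀≼C with comparable closing~rim (proj₂ C) (proj₂ (R zero))
        ... | inj₂ R≼C = R≼C
        ... | inj₁ C≼R =
          -- Here C ≤ R_0 ≤ S_1 ≤ S_0 ≤ S_last + 1 ≤ C + 1.
          ⊥-elim (closing≁spoke {x = suc zero} (λ ()) (λ ())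
            (squeeze⇒~˘ (C≼R ⊙ R≼S zero) (S≼S₀ _ ⊙ S₀≼S⁺ last ⊙ up-mono S≼C)))

        lastRim≼R : ∀ i → R lastRim ≼ R i
        lastRim≼R = >-weakInduction (λ i → R lastRim ≼ R i) ≼-refl
          (λ i below → below ⊙ R-descending i)

        chain-impossible : ⊥
        chain-impossible = rim≁rim (squeeze⇒~
          (R-descending (suc zero) ⊙ R-descending zero)
          (R₀≼C ⊙ C≼lastRim⁺ ⊙ up-mono (lastRim≼R _)))

  module _ (c : V → T → ℤ) (~⇔Close : ∀ u v → u ~ v ⇔ Close c u v) where

    private
      squeezed : ∀ i → ∃ λ j →
        let open Shifts c in
        (spoke i , j) ≼ (spoke zero , 0ℤ) × (spoke zero , 0ℤ) ≼ up (spoke i , j)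
      squeezed i = Shifts.Close⇒squeeze c (to (~⇔Close _ _) (spoke~spoke i zero)) 0ℤ

    no-such-counts : ⊥
    no-such-counts = [ forward , backward ]′
      (outside⊎inside c ~⇔Close S₀ S₁ (rim~spokeˡ zero) (rim~spokeʳ zero))
      where
      shift : Fin (4 ℕ.+ k) → ℤ
      -- The witness of `squeezed zero` need not be 0, but spoke 0 is the reference level.
      shift zero    = 0ℤ
      shift (suc i) = proj₁ (squeezed (suc i))

      S₀ S₁ : V × ℤ
      S₀ = spoke zero , 0ℤ
      S₁ = spoke (suc zero) , shift (suc zero)

      below : ∀ i → Shifts._≼_ c (spoke i , shift i) (spoke zero , 0ℤ)
      below zero    = Shifts.≼-refl c
      below (suc i) = proj₁ (proj₂ (squeezed (suc i)))

      above : ∀ i → Shifts._≼_ c (spoke zero , 0ℤ) (spoke i , ℤ.suc (shift i))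
      above zero    = Shifts.≼-up c
      above (suc i) = proj₂ (proj₂ (squeezed (suc i)))

      forward : Outside c ~⇔Close (rim zero) S₀ S₁ → ⊥
      forward = Chain.chain-impossible c ~⇔Close shift below above

      -- Under the negated counts, the cyclic order of the spokes is reversed.
      c⁻ : V → T → ℤ
      c⁻ = opposite c

      open Shifts c⁻

      ~⇔Close⁻ : ∀ u v → u ~ v ⇔ Close c⁻ u v
      ~⇔Close⁻ u v = mk⇔ (Close-opposite c ∘ to (~⇔Close u v))
                         (from (~⇔Close u v) ∘ Close-opposite⁻ c)

      -- −(S_i + 1) for i ≠ 0; the spoke 0 has to stay on top.
      shift⁻ : Fin (4 ℕ.+ k) → ℤ
      shift⁻ zero    = 0ℤ
      shift⁻ (suc i) = ℤ.- ℤ.suc (shift (suc i))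

      flip-upper : ∀ {u v i j} → Shifts._≼_ c (u , i) (v , ℤ.suc j) →
        (v , ℤ.- ℤ.suc j) ≼ (u , ℤ.- i)
      flip-upper {u} {v} {i} {j} p = pointwise λ t →
        ≤-by-difference (Shifts.at p t) (eq (c u t) (c v t) i j)
        where
        eq : ∀ a b i j → (b ℤ.+ (1ℤ ℤ.+ j)) ℤ.- (a ℤ.+ i) ≡
                         ((ℤ.- a) ℤ.+ (ℤ.- i)) ℤ.- ((ℤ.- b) ℤ.+ (ℤ.- (1ℤ ℤ.+ j)))
        eq = solve-∀

      -- The constant `suc (- suc i)` is `- i`, in the form that `up` produces from a shift by
      -- `- suc i`.
      flip-lower : ∀ {u v i j} → Shifts._≼_ c (u , i) (v , j) →
        (v , ℤ.- j) ≼ (u , ℤ.suc (ℤ.- ℤ.suc i))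
      flip-lower {u} {v} {i} {j} p = pointwise λ t →
        ≤-by-difference (Shifts.at p t) (eq (c u t) (c v t) i j)
        where
        eq : ∀ a b i j → (b ℤ.+ j) ℤ.- (a ℤ.+ i) ≡
                         ((ℤ.- a) ℤ.+ (1ℤ ℤ.+ (ℤ.- (1ℤ ℤ.+ i)))) ℤ.- ((ℤ.- b) ℤ.+ (ℤ.- j))
        eq = solve-∀

      below⁻ : ∀ i → (spoke i , shift⁻ i) ≼ (spoke zero , 0ℤ)
      below⁻ zero    = ≼-refl
      below⁻ (suc i) = flip-upper {j = shift (suc i)} (above (suc i))

      above⁻ : ∀ i → (spoke zero , 0ℤ) ≼ up (spoke i , shift⁻ i)
      above⁻ zero    = ≼-up
      above⁻ (suc i) = flip-lower (below (suc i))

      backward : Inside c ~⇔Close (rim zero) S₀ S₁ → ⊥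
      backward (x , S₁≼x , x≼S₀) =
        Chain.chain-impossible c⁻ ~⇔Close⁻ shift⁻ below⁻ above⁻
          -- From S_1 ≤ x ≤ S_0 follows -S_0 - 1 ≤ -x - 1 ≤ -S_1 - 1, which is `Outside` for the
          -- negated shifts.
          ( ℤ.- ℤ.suc x
          , flip-upper {j = x} (Shifts.up-mono c S₁≼x)
          , flip-lower x≼S₀)

-- Alternation in words through prefix counts.

count : ∀ {n} → Fin n → List (Fin n) → ℕ → ℕ
count v w t = length (filter (Fin._≟ v) (take t w))

Leads : ∀ {n} → Fin n → Fin n → List (Fin n) → Set
Leads x y w = ∀ t → count y w t ℕ.≤ count x w t × count x w t ℕ.≤ suc (count y w t)

restrict-comm : ∀ {n} (x y : Fin n) w → restrict x y w ≡ restrict y x w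
restrict-comm x y = filter-≐ _ _ (Sum.swap , Sum.swap)

-- Removing a leading `x` exchanges the roles of the letters; counting it again turns x ≤ y ≤ x + 1
-- into y ≤ x + 1 ≤ y + 1.
alternating⇒leads : ∀ {n} {x y : Fin n} → x ≢ y → ∀ w →
  AlternatingFrom x y (restrict x y w) → Leads x y w
alternating⇒leads x≢y w alt zero = z≤n , z≤n
alternating⇒leads x≢y [] alt (suc t) = z≤n , z≤n
alternating⇒leads {x = x} {y} x≢y (z ∷ w) alt (suc t) with z Fin.≟ x | z Fin.≟ y
alternating⇒leads x≢y (z ∷ w) alt (suc t) | yes refl | yes refl = contradiction refl x≢y
alternating⇒leads {x = x} {y} x≢y (z ∷ w) (_ ∷ alt) (suc t) | yes refl | no _
  with alternating⇒leads (x≢y ∘ sym) w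
         (subst (AlternatingFrom y x) (restrict-comm x y w) alt) t
... | x≤y , y≤1+x = y≤1+x , s≤s x≤y
alternating⇒leads x≢y (z ∷ w) (z≡x ∷ _) (suc t) | no z≢x | yes _ = contradiction z≡x z≢x
alternating⇒leads x≢y (z ∷ w) alt (suc t) | no _ | no _ = alternating⇒leads x≢y w alt t

leads⇒alternating : ∀ {n} {x y : Fin n} → x ≢ y → ∀ w →
  Leads x y w → AlternatingFrom x y (restrict x y w)
leads⇒alternating x≢y [] leads = []
leads⇒alternating {x = x} {y} x≢y (z ∷ w) leads
  -- The shifted bounds are abstracted as well, so that their counts reduce with the two decisions.
  with z Fin.≟ x | z Fin.≟ y | (λ t → leads (suc t))
... | yes refl | yes refl | _ = contradiction refl x≢y
... | yes refl | no _ | leads′ =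
  refl ∷ subst (AlternatingFrom y x) (restrict-comm y x w)
    (leads⇒alternating (x≢y ∘ sym) w
      (λ t → ℕ.s≤s⁻¹ (proj₂ (leads′ t)) , proj₁ (leads′ t)))
-- A leading `y` would give one `y` and no `x` in the prefix of length 1.
... | no _ | yes _ | leads′ = contradiction (proj₁ (leads′ 0)) λ ()
... | no _ | no _  | leads′ = leads⇒alternating x≢y w leads′

counts : ∀ {n} → List (Fin n) → Fin n → ℕ → ℤ
counts w v t = + count v w t

bounds⇒differences : ∀ {a b} → b ℕ.≤ a × a ℕ.≤ suc b →
  (0ℤ ℤ.≤ + a ℤ.- + b × + a ℤ.- + b ℤ.≤ 1ℤ) ×
  (ℤ.-1ℤ ℤ.≤ + b ℤ.- + a × + b ℤ.- + a ℤ.≤ 0ℤ)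
bounds⇒differences {a} {b} (b≤a , a≤1+b) =
  (≤-by-difference (+≤+ b≤a) (eq₁ (+ a) (+ b)) ,
   ≤-by-difference (+≤+ a≤1+b) (eq₂ (+ a) (+ b))) ,
  (≤-by-difference (+≤+ a≤1+b) (eq₃ (+ a) (+ b)) ,
   ≤-by-difference (+≤+ b≤a) (eq₄ (+ a) (+ b)))
  where
  eq₁ : ∀ a b → a ℤ.- b ≡ (a ℤ.- b) ℤ.- 0ℤ
  eq₁ = solve-∀
  eq₂ : ∀ a b → (1ℤ ℤ.+ b) ℤ.- a ≡ 1ℤ ℤ.- (a ℤ.- b)
  eq₂ = solve-∀
  eq₃ : ∀ a b → (1ℤ ℤ.+ b) ℤ.- a ≡ (b ℤ.- a) ℤ.- (ℤ.- 1ℤ)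
  eq₃ = solve-∀
  eq₄ : ∀ a b → a ℤ.- b ≡ 0ℤ ℤ.- (b ℤ.- a)
  eq₄ = solve-∀

≤⇐difference≥0 : ∀ {a b} → 0ℤ ℤ.≤ + a ℤ.- + b → b ℕ.≤ a
≤⇐difference≥0 = ℤ.drop‿+≤+ ∘ ℤ.0≤i-j⇒j≤i

≤⇐difference≤1 : ∀ {a b} → + a ℤ.- + b ℤ.≤ 1ℤ → a ℕ.≤ suc b
≤⇐difference≤1 {a} {b} d = ℤ.drop‿+≤+ (≤-by-difference d (eq (+ a) (+ b)))
  where
  eq : ∀ a b → 1ℤ ℤ.- (a ℤ.- b) ≡ (1ℤ ℤ.+ b) ℤ.- a
  eq = solve-∀

≤⇐difference≤0 : ∀ {a b} → + a ℤ.- + b ℤ.≤ 0ℤ → a ℕ.≤ b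
≤⇐difference≤0 = ℤ.drop‿+≤+ ∘ ℤ.i-j≤0⇒i≤j

≤⇐difference≥-1 : ∀ {a b} → ℤ.-1ℤ ℤ.≤ + a ℤ.- + b → b ℕ.≤ suc a
≤⇐difference≥-1 {a} {b} d = ℤ.drop‿+≤+ (≤-by-difference d (eq (+ a) (+ b)))
  where
  eq : ∀ a b → (a ℤ.- b) ℤ.- (ℤ.- 1ℤ) ≡ (1ℤ ℤ.+ a) ℤ.- b
  eq = solve-∀

alternate⇒close : ∀ {n} {x y : Fin n} w → x ≢ y → Alternate x y w → Close (counts w) x y
alternate⇒close w x≢y (_ , _ , inj₁ alt) =
  0ℤ , λ t → proj₁ (bounds⇒differences (alternating⇒leads x≢y w alt t))
alternate⇒close {x = x} {y} w x≢y (_ , _ , inj₂ alt) =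
  ℤ.-1ℤ , λ t → proj₂ (bounds⇒differences (alternating⇒leads (x≢y ∘ sym) w
    (subst (AlternatingFrom y x) (restrict-comm x y w) alt) t))

-- All counts vanish at t = 0, which leaves k = 0 and k = −1.
close⇒alternate : ∀ {n} {x y : Fin n} w → x ≢ y → x ∈ w → y ∈ w →
  Close (counts w) x y → Alternate x y w
close⇒alternate w x≢y x∈w y∈w (+ zero , bounds) =
  x∈w , y∈w , inj₁ (leads⇒alternating x≢y w λ t →
    ≤⇐difference≥0 (proj₁ (bounds t)) , ≤⇐difference≤1 (proj₂ (bounds t)))
close⇒alternate {x = x} {y} w x≢y x∈w y∈w (-[1+ zero ] , bounds) =
  x∈w , y∈w , inj₂ (subst (AlternatingFrom y x) (restrict-comm y x w)
    (leads⇒alternating (x≢y ∘ sym) w λ t →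
      ≤⇐difference≤0 (proj₂ (bounds t)) , ≤⇐difference≥-1 (proj₁ (bounds t))))
close⇒alternate w x≢y x∈w y∈w (+ suc k , bounds) with +≤+ () ← proj₁ (bounds 0)
close⇒alternate w x≢y x∈w y∈w (-[1+ suc k ] , bounds) with () ← proj₂ (bounds 0)

-- Edge lists and the line graph of the wheel.

module _ {n} (es : List (Fin n × Fin n)) where

  -- Unlike adjacency in `lineGraph` this is reflexive, as `Close` is, so the two can agree on all
  -- pairs.
  Incident : Rel (Fin (length es)) 0ℓ
  Incident i j = ShareEndpoint (lookup es i) (lookup es j)

  incident⁺ : ∀ {e f} (e∈es : e ∈ es) (f∈es : f ∈ es) →
    ShareEndpoint e f → Incident (index e∈es) (index f∈es)
  incident⁺ e∈es f∈es = subst₂ ShareEndpoint (lookup-index e∈es) (lookup-index f∈es)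

  incident⁻ : ∀ {e f} (e∈es : e ∈ es) (f∈es : f ∈ es) →
    Incident (index e∈es) (index f∈es) → ShareEndpoint e f
  incident⁻ e∈es f∈es =
    subst₂ ShareEndpoint (sym (lookup-index e∈es)) (sym (lookup-index f∈es))

incident⇔close : ∀ {n} (G : Graph n) ((w , _) : Representable (lineGraph G)) →
  ∀ i j → Incident (edges G) i j ⇔ Close (counts w) i j
incident⇔close G (w , occurs , represents) i j with i Fin.≟ j
... | yes refl = mk⇔ (λ _ → Close-refl (counts w))
                     (λ _ → _ , inj₁ refl , inj₁ refl)
... | no i≢j = mk⇔
  (λ share → alternate⇒close w i≢j (from (represents i j i≢j) (i≢j , share)))
  (λ close → proj₂ (to (represents i j i≢j)
                       (close⇒alternate w i≢j (occurs i) (occurs j) close)))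

∈-edges : ∀ {n} (G : Graph n) {u v} → u Fin.< v → Graph._~_ G u v → (u , v) ∈ edges G
∈-edges {n} G {u} {v} u<v u~v =
  ∈-filter⁺ (λ (u , v) → (u Fin.<? v) ×-dec Graph._~?_ G u v)
    (∈-cartesianProduct⁺ (∈-allFin u) (∈-allFin v)) (u<v , u~v)

module _ {k : ℕ} (es : List (Fin (5 ℕ.+ k) × Fin (5 ℕ.+ k)))
  (spoke∈   : ∀ i → (zero , suc i) ∈ es)
  (rim∈     : ∀ i → (suc (inject₁ i) , suc (suc i)) ∈ es)
  (closing∈ : (suc zero , suc (fromℕ (3 ℕ.+ k))) ∈ es)
  where

  lineGraphOfWheel : LineGraphOfWheel k (Incident es)
  lineGraphOfWheel = record
    { spoke         = λ i → index (spoke∈ i)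
    ; rim           = λ i → index (rim∈ i)
    ; closing       = index closing∈
    ; spoke~spoke   = λ i j → incident⁺ es (spoke∈ i) (spoke∈ j) (_ , inj₁ refl , inj₁ refl)
    ; rim~spokeˡ    = λ i → incident⁺ es (rim∈ i) (spoke∈ _) (_ , inj₁ refl , inj₂ refl)
    ; rim~spokeʳ    = λ i → incident⁺ es (rim∈ i) (spoke∈ _) (_ , inj₂ refl , inj₂ refl)
    ; rim≁spoke     = λ {i} {x} x≢i x≢1+i → λ r~s →
        disjoint x≢i x≢1+i (incident⁻ es (rim∈ i) (spoke∈ x) r~s)
    ; closing~first = incident⁺ es closing∈ (spoke∈ _) (_ , inj₁ refl , inj₂ refl)
    ; closing~last  = incident⁺ es closing∈ (spoke∈ _) (_ , inj₂ refl , inj₂ refl)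
    ; closing≁spoke = λ {x} x≢0 x≢last → λ c~s →
        disjoint x≢0 x≢last (incident⁻ es closing∈ (spoke∈ x) c~s)
    ; rim~rim       = λ i → incident⁺ es (rim∈ _) (rim∈ _) (_ , inj₂ refl , inj₁ refl)
    ; rim~closing   = incident⁺ es (rim∈ _) closing∈ (_ , inj₂ refl , inj₂ refl)
    ; closing~rim   = incident⁺ es closing∈ (rim∈ zero) (_ , inj₁ refl , inj₁ refl)
    ; rim≁rim       = λ r~r → rims-disjoint (incident⁻ es (rim∈ _) (rim∈ _) r~r)
    }
    where
    disjoint : ∀ {n} {a b x : Fin n} → x ≢ a → x ≢ b →
      ¬ ShareEndpoint (suc a , suc b) (zero , suc x)
    disjoint x≢a x≢b (_ , inj₁ refl , inj₂ refl) = x≢a refl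
    disjoint x≢a x≢b (_ , inj₂ refl , inj₂ refl) = x≢b refl
    -- Four distinct rim vertices are needed here: in a triangle any two rim edges meet.
    rims-disjoint : ∀ {n} → ¬ ShareEndpoint {5 ℕ.+ n}
      (suc zero , suc (suc zero)) (suc (suc (suc zero)) , suc (suc (suc (suc zero))))
    rims-disjoint (_ , inj₁ refl , inj₁ ())
    rims-disjoint (_ , inj₁ refl , inj₂ ())
    rims-disjoint (_ , inj₂ refl , inj₁ ())
    rims-disjoint (_ , inj₂ refl , inj₂ ())

theorem2 : ∀ (n : ℕ) → n ≥ 3 → ¬ Representable (lineGraph (wheel (suc n)))
theorem2 (suc (suc (suc k))) (s≤s (s≤s (s≤s z≤n))) representation =
  no-such-counts
    (lineGraphOfWheel (edges W) spoke∈ rim∈ closing∈)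
    (counts (proj₁ representation))
    (incident⇔close W representation)
  where
  W : Graph (5 ℕ.+ k)
  W = wheel (4 ℕ.+ k)

  spoke∈ : ∀ i → (zero , suc i) ∈ edges W
  spoke∈ i = ∈-edges W (s≤s z≤n) tt

  rim∈ : ∀ i → (suc (inject₁ i) , suc (suc i)) ∈ edges W
  rim∈ i = ∈-edges W (s≤s i<1+i)
    ((λ i≡1+i → ℕ.<⇒≢ i<1+i (cong toℕ i≡1+i)) ,
     inj₁ (inj₁ (cong suc (sym (Fin.toℕ-inject₁ i)))))
    where
    i<1+i : toℕ (inject₁ i) ℕ.< suc (toℕ i)
    i<1+i = s≤s (ℕ.≤-reflexive (Fin.toℕ-inject₁ i))

  closing∈ : (suc zero , suc (fromℕ (3 ℕ.+ k))) ∈ edges W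
  closing∈ = ∈-edges W (s≤s (s≤s z≤n))
    -- Edges are listed in increasing order, so the wrap-around pair of `Successive` is read
    -- backwards.
    ((λ ()) , inj₂ (inj₂ (cong suc (Fin.toℕ-fromℕ (3 ℕ.+ k)) , refl)))
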